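{- Let $3 \leqslant m \leqslant n$ and $k\geqslant 0$ be integers. If the complete bipartite graph $K_{m,n}$ has a $B_{k}^{m}$-EPG representation (an EPG representation in which every path is monotonic and has at most $k$ bends), then $$n\left(m - \left\lceil \frac{k+1}{2}\right\rceil\right) \leqslant \binom{m}{2}\left( 2\left\lfloor \frac{k+1}{2}\right\rfloor \left\lceil \frac{k+1}{2}\right\rceil + k \right) + \frac{1}{4}m^2\left(1 + \left\lceil \frac{k+1}{2}\right\rceil - \left\lfloor \frac{k+1}{2}\right\rfloor \right).$$
   Context: $K_{m,n}$ is the complete bipartite graph with partition classes of sizes $m$ and $n$. A grid consists of horizontal grid lines (rows, increasing from bottom to top) and vertical grid lines (columns, increasing from left to right). A grid point is a crossing of two grid lines. A grid edge is the part of a grid line between two consecutive grid points. A path on a grid consists of two grid points (its end points) and a number of consecutive grid edges connecting them. A bend of a path is a turn of the path at a grid point. An EPG representation of a graph $G$ assigns to each vertex $v$ of $G$ a path $P_v$ on a common grid such that two distinct vertices $v,w$ are adjacent in $G$ if and only if $P_v$ and $P_w$ share at least one grid edge. A path is monotonic if it is ascending in both columns and rows, i.e. it has the shape of a staircase going upwards from left to right. In the term "$B_k^m$-EPG representation" the superscript $m$ is just a symbol for "monotonic" and is unrelated to the integer $m$. -}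

module Defs where

open import Data.Empty using (⊥)
open import Data.Fin using (Fin; suc; inject₁)
open import Data.Integer using (+_)
open import Data.List using (List; []; _∷_)
open import Data.List.Membership.Propositional using (_∈_)
open import Data.Nat using (ℕ; suc; _+_; _≤_)
open import Data.Product using (Σ-syntax; ∃-syntax; _×_; _,_)
open import Data.Rational using (ℚ; _/_)
open import Data.Sum using (_⊎_; inj₁; inj₂)
open import Data.Unit using (⊤; tt)
open import Function.Bundles using (_⇔_)
open import Relation.Binary.PropositionalEquality using (_≢_)
open import Relation.Nullary using (¬_)

record Graph : Set₁ where
  field
    Vertex  : Set
    Adj     : Vertex → Vertex → Set
    sym     : ∀ {v w} → Adj v w → Adj w v
    irrefl  : ∀ {v} → ¬ Adj v v

K : ℕ → ℕ → Graph
K m n = record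
  { Vertex = Fin m ⊎ Fin n
  ; Adj    = Adj
  ; sym    = λ {v} {w} → sym v w
  ; irrefl = λ {v} → irrefl v
  }
  where
  Adj : Fin m ⊎ Fin n → Fin m ⊎ Fin n → Set
  Adj (inj₁ _) (inj₁ _) = ⊥
  Adj (inj₁ _) (inj₂ _) = ⊤
  Adj (inj₂ _) (inj₁ _) = ⊤
  Adj (inj₂ _) (inj₂ _) = ⊥

  sym : ∀ v w → Adj v w → Adj w v
  sym (inj₁ _) (inj₂ _) _ = tt
  sym (inj₂ _) (inj₁ _) _ = tt

  irrefl : ∀ v → ¬ Adj v v
  irrefl (inj₁ _) ()
  irrefl (inj₂ _) ()

-- The grid has c + 1 columns and r + 1 rows, both numbered from 0; a grid
-- point is a pair (column , row).
module Grid (c r : ℕ) where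

  GridPoint : Set
  GridPoint = Fin (suc c) × Fin (suc r)

  -- hor x y joins columns x and x + 1 along row y; ver x y joins rows y and
  -- y + 1 along column x.
  data GridEdge : Set where
    hor : Fin c → Fin (suc r) → GridEdge
    ver : Fin (suc c) → Fin r → GridEdge

  -- The left, respectively bottom, end of a grid edge.
  lower : GridEdge → GridPoint
  lower (hor x y) = inject₁ x , y
  lower (ver x y) = x , inject₁ y

  -- The right, respectively top, end of a grid edge.
  upper : GridEdge → GridPoint
  upper (hor x y) = suc x , y
  upper (ver x y) = x , suc y

  -- A path is listed from one end point to the other; forward traverses an
  -- edge rightwards or upwards, backward leftwards or downwards.
  -- Self-intersections are not excluded here, but monotonic paths have none.
  data Path : GridPoint → GridPoint → Set where
    end      : ∀ p → Path p p
    forward  : ∀ e {q} → Path (upper e) q → Path (lower e) q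
    backward : ∀ e {q} → Path (lower e) q → Path (upper e) q

  edges : ∀ {p q} → Path p q → List GridEdge
  edges (end _)        = []
  edges (forward e P)  = e ∷ edges P
  edges (backward e P) = e ∷ edges P

  turn : GridEdge → GridEdge → ℕ
  turn (hor _ _) (hor _ _) = 0
  turn (hor _ _) (ver _ _) = 1
  turn (ver _ _) (hor _ _) = 1
  turn (ver _ _) (ver _ _) = 0

  turns : List GridEdge → ℕ
  turns (e ∷ f ∷ es) = turn e f + turns (f ∷ es)
  turns _            = 0

  bends : ∀ {p q} → Path p q → ℕ
  bends P = turns (edges P)

  -- Listing a staircase from its lower left end loses no generality, as edge
  -- sharing and bends do not depend on the direction of traversal.
  Monotonic : ∀ {p q} → Path p q → Set
  Monotonic (end _)        = ⊤
  Monotonic (forward _ P)  = Monotonic P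
  Monotonic (backward _ _) = ⊥

  ShareEdge : ∀ {p q p′ q′} → Path p q → Path p′ q′ → Set
  ShareEdge P Q = ∃[ e ] (e ∈ edges P × e ∈ edges Q)

record EPGRepresentation (G : Graph) : Set where
  open Graph G
  field
    {c r} : ℕ
  open Grid c r public
  field
    source target : Vertex → GridPoint
    path          : ∀ v → Path (source v) (target v)
    represents    : ∀ v w → v ≢ w → Adj v w ⇔ ShareEdge (path v) (path w)

HasMonotonicEPG : ℕ → Graph → Set
HasMonotonicEPG k G =
  Σ[ R ∈ EPGRepresentation G ] (let open EPGRepresentation R in
    ∀ v → Monotonic (path v) × bends (path v) ≤ k)

fromℕ : ℕ → ℚ
fromℕ n = + n / 1

{-# OPTIONS --safe #-}
module Submission where

-- A monotonic path with at most k bends is a staircase of k + 1 segments, which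
-- we cut into ⌈(k+1)/2⌉ blocks of two consecutive segments.  Let Q belong to the
-- class of size n, and let P and P′ be paths of the class of size m that share
-- edges with the same block of Q.  Then Q runs from an edge of P to an edge of P′
-- with at most one bend, and the two segments of P and P′ involved determine an
-- edge of Q: the one in front of the bend, or, if they are collinear, the last
-- edge of the first segment.  Hence different Q use different pairs of segments.
-- For given Q, all but at most ⌈(k+1)/2⌉ of the m paths have a predecessor in the
-- same block, so that n (m − ⌈(k+1)/2⌉) such charges arise.
--
-- To bound the charges between P and P′, distribute them over pairs of corners.
-- A bend from segment s of P to segment t of P′ means that corner s of P (the
-- lower end of segment s) is strictly below and to the left of corner t + 1 of P′
-- (the upper end of segment t), and conversely with P and P′ exchanged, so a pair
-- of corners receives at most one charge of this kind; a collinear pair of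
-- segments is charged to a pair of corners on a common grid line.  The charged
-- pairs of corners have indices of equal parity if P and P′ set out in the same
-- direction, and of different parity otherwise.  Counting them gives
-- 2 ⌊(k+1)/2⌋ ⌈(k+1)/2⌉ + k pairs in the first case, where the pair of first
-- corners and the pair of last corners are never charged, and
-- 1 + ⌈(k+1)/2⌉ − ⌊(k+1)/2⌋ more in the second, which concerns at most m² / 4
-- pairs of paths.

open import Data.Bool as Bool using (Bool; true; false; not; if_then_else_)
open import Data.Bool.Properties using (not-involutive; ¬-not)
open import Data.Empty using (⊥; ⊥-elim)
open import Data.Fin as Fin using (Fin; zero; suc; toℕ; fromℕ<)
import Data.Fin.Properties as Fin
open import Data.Integer as ℤ using (+_)
import Data.Integer.Properties as ℤ
open import Data.List
  using (List; []; _∷_; _++_; map; concatMap; length; lookup; cartesianProduct; allFin; tabulate)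
open import Data.List.Membership.Propositional using (_∈_)
open import Data.List.Membership.Propositional.Properties
  using (∈-map⁺; ∈-++⁺ˡ; ∈-++⁺ʳ; ∈-cartesianProduct⁺; ∈-concatMap⁺; ∈-tabulate⁺)
open import Data.List.Properties using (length-++; length-map; length-tabulate; concatMap-++)
open import Data.List.Relation.Unary.Any as Any using (here; there; index)
open import Data.List.Relation.Unary.Any.Properties using (lookup-index)
open import Data.Nat as ℕ using (ℕ; ⌊_/2⌋; ⌈_/2⌉)
open import Data.Nat.Combinatorics using (_C_; nC1≡n; nCk+nC[k+1]≡[n+1]C[k+1])
import Data.Nat.Properties as ℕ
open import Data.Nat.Tactic.RingSolver using (solve-∀)
open import Data.Product using (∃₂; ∃-syntax; _×_; _,_; proj₁; proj₂)
import Data.Rational.Properties as ℚ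
open import Data.Rational.Solver using (module +-*-Solver)
import Data.Rational.Unnormalised as ℚᵘ
import Data.Rational.Unnormalised.Properties as ℚᵘ
open import Data.Sum using (_⊎_; inj₁; inj₂)
open import Data.Sum.Function.Propositional using (_⊎-↔_)
open import Data.Sum.Properties using (inj₁-injective; inj₂-injective)
open import Data.Unit using (⊤; tt)
open import Defs
open import Function using (_∘_)
open import Function.Bundles using (Injection; Equivalence; _↣_; mk↣)
open import Function.Construct.Composition using (_↣-∘_)
open import Function.Construct.Identity using (↔-id)
open import Function.Construct.Symmetry using (↔-sym)
open import Function.Properties.Inverse using (↔⇒↣)
open import Relation.Binary.Definitions using (tri<; tri≈; tri>)
open import Relation.Binary.PropositionalEquality
  using (_≡_; _≢_; refl; sym; trans; cong; cong₂; subst; module ≡-Reasoning)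
open import Relation.Nullary using (¬_; Dec; yes; no; does; contradiction)
open import Relation.Nullary.Decidable using (_×-dec_)

module _ where

  open import Data.Nat
    using (zero; suc; pred; _+_; _*_; _∸_; _⊔_; _≤_; _<_; _≟_; z≤n; s≤s; z<s)
  open import Data.Nat.Properties

  -- Staircases and charges

  alternate : Bool → ℕ → Bool
  alternate d zero    = d
  alternate d (suc s) = alternate (not d) s

  alternate-suc : ∀ d s → alternate d (suc s) ≡ not (alternate d s)
  alternate-suc d zero    = refl
  alternate-suc d (suc s) = alternate-suc (not d) s

  -- (d , u , w) is the edge in direction d (true for horizontal) from
  -- coordinate u to u + 1 on the grid line whose other coordinate is w.
  Edge : Set
  Edge = Bool × ℕ × ℕ

  -- Segment s leads from corner s to corner suc s and may be degenerate.
  record Stair : Set where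
    field
      start  : Bool
      corner : Bool → ℕ → ℕ

    side : ℕ → Bool
    side = alternate start

    field
      level : ∀ s → corner (not (side s)) (suc s) ≡ corner (not (side s)) s

  open Stair

  side-suc : ∀ S s → side S (suc s) ≡ not (side S s)
  side-suc S = alternate-suc (start S)

  record OnSegment (S : Stair) (s : ℕ) (e : Edge) : Set where
    constructor onSegment
    private
      d = proj₁ e
      u = proj₁ (proj₂ e)
      w = proj₂ (proj₂ e)
    field
      parallel : d ≡ side S s
      from      : corner S d s ≤ u
      to        : u < corner S d (suc s)
      line      : corner S (not d) s ≡ w

  open OnSegment

  line′ : ∀ {S s d u w} → OnSegment S s (d , u , w) → corner S (not d) (suc s) ≡ w
  line′ {S} {s} o@(onSegment refl _ _ _) = trans (level S s) (line o)

  line-not : ∀ {S s d u w} → OnSegment S s (not d , u , w) → corner S d s ≡ w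
  line-not {S} {s} {d} {w = w} o = subst (λ x → corner S x s ≡ w) (not-involutive d) (line o)

  line-not′ : ∀ {S s d u w} → OnSegment S s (not d , u , w) → corner S d (suc s) ≡ w
  line-not′ {S} {s} {d} {w = w} o =
    subst (λ x → corner S x (suc s) ≡ w) (not-involutive d) (line′ o)

  -- How a path Q runs from one path to another within a block

  _∋_ : Stair → Edge → Set
  S ∋ e = ∃[ s ] OnSegment S s e

  Disjoint : Stair → Stair → Set
  Disjoint A B = ∀ {e} → A ∋ e → ¬ B ∋ e

  -- Models a `Q` that leaves segment `s` of `A` by bending onto segment `t` of `B`. The bend lies
  -- where the lines of these segments cross, so `meets` names the edge in front of it by means of
  -- `A` and `B` alone.
  record Perpendicular (A B Q : Stair) (s t : ℕ) : Set where
    field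
      {d}     : Bool
      dirA    : d ≡ side A s
      dirB    : not d ≡ side B t
      along   : corner A d s < corner B d (suc t)
      across  : corner A (not d) s < corner B (not d) (suc t)
      meets   : Q ∋ (d , pred (corner B d (suc t)) , corner A (not d) s)

  record Collinear (A B Q : Stair) (s t : ℕ) : Set where
    field
      {d}       : Bool
      dirA      : d ≡ side A s
      dirB      : d ≡ side B t
      same-line : corner A (not d) s ≡ corner B (not d) t
      properA   : corner A d s < corner A d (suc s)
      before    : corner A d (suc s) ≤ corner B d t
      properB   : corner B d t < corner B d (suc t)
      meets     : Q ∋ (d , pred (corner A d (suc s)) , corner A (not d) s)

  Collinear± : (A B Q : Stair) (s t : ℕ) → Set
  Collinear± A B Q s t = Collinear A B Q s t ⊎ Collinear B A Q t s

  m<n⇒pred[n]<n : ∀ {m n} → m < n → pred n < n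
  m<n⇒pred[n]<n (s≤s _) = ≤-refl

  module _ {A B Q : Stair} {s t : ℕ} where

    bend⇒perpendicular : ∀ {a d u w u′ w′} →
      OnSegment A s (d , u , w) → OnSegment B t (not d , u′ , w′) →
      OnSegment Q a (d , u , w) → OnSegment Q (suc a) (not d , u′ , w′) →
      Perpendicular A B Q s t
    bend⇒perpendicular {a} {d} {u} {w} {u′} {w′} oA oB oQ oQ′ = record
      { dirA   = parallel oA
      ; dirB   = parallel oB
      ; along  = ≤-<-trans (from oA) u<B
      ; across = ≤-<-trans (≤-trans (≤-reflexive (trans (line oA) (sym (line′ oQ)))) (from oQ′))
                   (to oB)
      ; meets  = a , onSegment (parallel oQ) (≤-trans (from oQ) (<⇒≤pred u<B))
                   (subst (pred (corner B d (suc t)) <_) B≡Q (m<n⇒pred[n]<n u<B))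
                   (trans (line oQ) (sym (line oA)))
      }
      where
      -- Both segments carry the edge behind the bend, so the bend of `Q` lies on the line of
      -- segment `t` of `B`.
      B≡Q : corner B d (suc t) ≡ corner Q d (suc a)
      B≡Q = trans (line-not′ oB) (sym (line-not oQ′))
      u<B : u < corner B d (suc t)
      u<B = subst (u <_) (sym B≡Q) (to oQ)

    ordered⇒collinear : ∀ {a d u u′ w} → Disjoint A B →
      OnSegment A s (d , u , w) → OnSegment B t (d , u′ , w) →
      OnSegment Q a (d , u , w) → OnSegment Q a (d , u′ , w) →
      u < u′ → Collinear A B Q s t
    ordered⇒collinear {a} {d} {u} {u′} {w} disj oA oB oQ oQ′ u<u′ = record
      { dirA      = parallel oA
      ; dirB      = parallel oB
      ; same-line = trans (line oA) (sym (line oB))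
      ; properA   = ≤-<-trans (from oA) (to oA)
      ; before    = before
      ; properB   = ≤-<-trans (from oB) (to oB)
      ; meets     = a , onSegment (parallel oQ) (≤-trans (from oQ) (<⇒≤pred (to oA)))
                      (<-trans (<-≤-trans (m<n⇒pred[n]<n (to oA)) (≤-trans before (from oB)))
                        (to oQ′))
                      (trans (line oQ) (sym (line oA)))
      }
      where
      before : corner A d (suc s) ≤ corner B d t
      -- If the segments overlapped, the edge starting at the larger of `u` and the lower end of
      -- segment `t` would lie on both.
      before = ≮⇒≥ λ B<A → disj {d , u ⊔ corner B d t , w}
        (s , onSegment (parallel oA) (≤-trans (from oA) (m≤m⊔n u _))
               (⊔-pres-<m (to oA) B<A) (line oA))
        (t , onSegment (parallel oB) (m≤n⊔m u _)
               (⊔-pres-<m (<-trans u<u′ (to oB)) (≤-<-trans (from oB) (to oB))) (line oB))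

  ≡side⇒collinear± : ∀ {A B Q s t a e f} → Disjoint A B →
    OnSegment A s e → OnSegment B t f → OnSegment Q a e → OnSegment Q a f →
    Collinear± A B Q s t
  ≡side⇒collinear± {e = _ , u , _} {f = _ , v , _} disj oA oB oQ oQ′
    with refl ← trans (parallel oQ) (sym (parallel oQ′))
    with refl ← trans (sym (line oQ)) (line oQ′)
    with <-cmp u v
  ... | tri< u<v _ _  = inj₁ (ordered⇒collinear disj oA oB oQ oQ′ u<v)
  ... | tri≈ _ refl _ = contradiction (_ , oB) (disj (_ , oA))
  ... | tri> _ _ v<u  = inj₂ (ordered⇒collinear (λ x y → disj y x) oB oA oQ′ oQ v<u)

  -- If both segments are the last ones, the pair of their upper ends must not be
  -- charged and the pair of lower ends is used.
  data Slot (k : ℕ) : (s t p r : ℕ) → Set where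
    upperEnds : ∀ {s t} → s ≢ k ⊎ t ≢ k → Slot k s t (suc s) (suc t)
    lowerEnds : Slot k k k k k

  slot : ∀ k s t → ∃₂ (Slot k s t)
  slot k s t with s ≟ k | t ≟ k
  ... | yes refl | yes refl = k , k , lowerEnds
  ... | no s≢k   | _        = suc s , suc t , upperEnds (inj₁ s≢k)
  ... | yes _    | no t≢k   = suc s , suc t , upperEnds (inj₂ t≢k)

  -- A bend charges corners that are strictly comparable in both coordinates, collinear segments
  -- charge corners with a coordinate in common. This keeps the constructors apart in
  -- `charge-unique`.
  data Charge (k : ℕ) (A B Q : Stair) : (p r : ℕ) → Set where
    perp→ : ∀ {s t} → s ≤ k → t ≤ k → Perpendicular A B Q s t → Charge k A B Q s (suc t)
    perp← : ∀ {s t} → s ≤ k → t ≤ k → Perpendicular B A Q t s → Charge k A B Q (suc s) t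
    coll  : ∀ {s t p r} → s ≤ k → t ≤ k → Collinear± A B Q s t → Slot k s t p r →
            Charge k A B Q p r

  -- Half the index of a segment of Q is the number of its block, so this leaves Q at most one bend
  -- within a block.
  ⌊/2⌋-fibres : ∀ a b → ⌊ a /2⌋ ≡ ⌊ b /2⌋ → a ≡ b ⊎ b ≡ suc a ⊎ a ≡ suc b
  ⌊/2⌋-fibres 0             0             _  = inj₁ refl
  ⌊/2⌋-fibres 0             1             _  = inj₂ (inj₁ refl)
  ⌊/2⌋-fibres 1             0             _  = inj₂ (inj₂ refl)
  ⌊/2⌋-fibres 1             1             _  = inj₁ refl
  ⌊/2⌋-fibres (suc (suc a)) (suc (suc b)) eq with ⌊/2⌋-fibres a b (cong pred eq)
  ... | inj₁ refl        = inj₁ refl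
  ... | inj₂ (inj₁ refl) = inj₂ (inj₁ refl)
  ... | inj₂ (inj₂ refl) = inj₂ (inj₂ refl)

  charge : ∀ {k A B Q s t a b e f} → Disjoint A B → s ≤ k → t ≤ k →
    OnSegment A s e → OnSegment B t f → OnSegment Q a e → OnSegment Q b f →
    ⌊ a /2⌋ ≡ ⌊ b /2⌋ → ∃₂ (Charge k A B Q)
  charge {k} {Q = Q} {s} {t} {a} {b} disj s≤k t≤k oA oB oQ oQ′ eq with ⌊/2⌋-fibres a b eq
  ... | inj₁ refl =
    _ , _ , coll s≤k t≤k (≡side⇒collinear± disj oA oB oQ oQ′) (proj₂ (proj₂ (slot k s t)))
  -- Consecutive segments of `Q` are perpendicular, which makes the direction of `f` the opposite of
  -- that of `e`.
  ... | inj₂ (inj₁ refl)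
    with refl ← trans (parallel oQ′) (trans (side-suc Q a) (cong not (sym (parallel oQ)))) =
    _ , _ , perp→ s≤k t≤k (bend⇒perpendicular oA oB oQ oQ′)
  ... | inj₂ (inj₂ refl)
    with refl ← trans (parallel oQ) (trans (side-suc Q b) (cong not (sym (parallel oQ′)))) =
    _ , _ , perp← s≤k t≤k (bend⇒perpendicular oB oA oQ′ oQ)

  -- A pair of corners is charged at most once

  perpendicular⇒≪ : ∀ {A B Q s t} → Perpendicular A B Q s t →
    ∀ x → corner A x s < corner B x (suc t)
  perpendicular⇒≪ {A} {B} {Q} {s} {t} P x with x Bool.≟ d
    where open Perpendicular P
  ... | yes refl = Perpendicular.along P
  ... | no  x≢d with refl ← ¬-not x≢d = Perpendicular.across P

  -- The coordinate across the common line is constant along both segments, so either choice of ends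
  -- made by `Slot` gives aligned corners.
  collinear⇒aligned : ∀ {A B Q s t} → Collinear A B Q s t →
    ∃[ x ] (corner A x s ≡ corner B x t × corner A x (suc s) ≡ corner B x (suc t))
  collinear⇒aligned {A} {B} {s = s} {t} X = not d , same-line , suc-line dirA dirB
    where
    open Collinear X
    suc-line : d ≡ side A s → d ≡ side B t → corner A (not d) (suc s) ≡ corner B (not d) (suc t)
    suc-line refl eq = trans (level A s) (trans same-line
      (sym (subst (λ x → corner B (not x) (suc t) ≡ corner B (not x) t) (sym eq) (level B t))))

  slot-aligned : ∀ {k A B Q s t p r} → Collinear± A B Q s t → Slot k s t p r →
    ∃[ x ] corner A x p ≡ corner B x r
  slot-aligned (inj₁ X) (upperEnds _) with x , _ , eq ← collinear⇒aligned X = x , eq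
  slot-aligned (inj₁ X) lowerEnds     with x , eq , _ ← collinear⇒aligned X = x , eq
  slot-aligned (inj₂ X) (upperEnds _) with x , _ , eq ← collinear⇒aligned X = x , sym eq
  slot-aligned (inj₂ X) lowerEnds     with x , eq , _ ← collinear⇒aligned X = x , sym eq

  -- Each of two segments of positive length would end before the other begins.
  collinear-antisym : ∀ {A B Q R s t} → Collinear A B Q s t → ¬ Collinear B A R t s
  collinear-antisym {A} {B} {s = s} {t} X Y
    with refl ← trans (Collinear.dirA X) (sym (Collinear.dirB Y)) =
    <-asym (<-≤-trans (Collinear.properA X) (Collinear.before X))
           (<-≤-trans (Collinear.properA Y) (Collinear.before Y))

  -- The side of `A` determines the direction, and then both `meets` fields speak of one edge.
  collinear-unique : ∀ {A B Q R s t} → Collinear A B Q s t → Collinear A B R s t →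
    ∃[ e ] (Q ∋ e × R ∋ e)
  collinear-unique X Y with refl ← trans (Collinear.dirA X) (sym (Collinear.dirA Y)) =
    _ , Collinear.meets X , Collinear.meets Y

  collinear±-unique : ∀ {A B Q R s t} → Collinear± A B Q s t → Collinear± A B R s t →
    ∃[ e ] (Q ∋ e × R ∋ e)
  collinear±-unique (inj₁ X) (inj₁ Y) = collinear-unique X Y
  collinear±-unique (inj₁ X) (inj₂ Y) = contradiction Y (collinear-antisym X)
  collinear±-unique (inj₂ X) (inj₁ Y) = contradiction X (collinear-antisym Y)
  collinear±-unique (inj₂ X) (inj₂ Y) = collinear-unique X Y

  perpendicular-unique : ∀ {A B Q R s t} → Perpendicular A B Q s t → Perpendicular A B R s t →
    ∃[ e ] (Q ∋ e × R ∋ e)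
  perpendicular-unique X Y with refl ← trans (Perpendicular.dirA X) (sym (Perpendicular.dirA Y)) =
    _ , Perpendicular.meets X , Perpendicular.meets Y

  -- The corners suc s and suc t would coincide, although one of the segments s
  -- and t lies before the other.
  ¬collinear-collinear : ∀ {A B Q R s t} →
    Collinear A B Q s t → ¬ Collinear± A B R (suc s) (suc t)
  ¬collinear-collinear {A} {B} {s = s} {t} X Y =
    <⇒≢ (≤-<-trans (Collinear.before X) (Collinear.properB X)) (lines-meet Y)
    where
    d = Collinear.d X
    not-not : ∀ {x} → x ≡ side A (suc s) → not x ≡ d
    not-not refl =
      trans (cong not (trans (side-suc A s) (cong not (sym (Collinear.dirA X))))) (not-involutive d)
    lines-meet : ∀ {R} → Collinear± A B R (suc s) (suc t) → corner A d (suc s) ≡ corner B d (suc t)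
    lines-meet (inj₁ Y) = subst (λ x → corner A x (suc s) ≡ corner B x (suc t))
      (not-not (Collinear.dirA Y)) (Collinear.same-line Y)
    lines-meet (inj₂ Y) = subst (λ x → corner A x (suc s) ≡ corner B x (suc t))
      (not-not (Collinear.dirB Y)) (sym (Collinear.same-line Y))

  ¬collinear±-collinear± : ∀ {A B Q R s t} →
    Collinear± A B Q s t → ¬ Collinear± A B R (suc s) (suc t)
  ¬collinear±-collinear± (inj₁ X) Y        = ¬collinear-collinear X Y
  ¬collinear±-collinear± (inj₂ X) (inj₁ Y) = ¬collinear-collinear X (inj₂ Y)
  ¬collinear±-collinear± (inj₂ X) (inj₂ Y) = ¬collinear-collinear X (inj₁ Y)

  ¬perp→-perp← : ∀ {A B Q R s t p r} → Perpendicular A B Q s t → Perpendicular B A R r p →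
    s ≡ suc p → suc t ≡ r → ⊥
  ¬perp→-perp← P P′ refl refl = <-asym (perpendicular⇒≪ P true) (perpendicular⇒≪ P′ true)

  -- The three kinds of charge exclude one another: corner `p` is strictly below `r` in both
  -- coordinates, strictly above, or level with it in one. Within a kind the corners determine the
  -- segments, except that `(k , k)` may be the upper ends of one collinear pair or the lower ends
  -- of the next; these two pairs cannot both be collinear.
  charge-unique : ∀ {k A B Q R p r} → Charge k A B Q p r → Charge k A B R p r →
    ∃[ e ] (Q ∋ e × R ∋ e)
  charge-unique (perp→ _ _ P) (perp→ _ _ P′) = perpendicular-unique P P′
  charge-unique (perp→ _ _ P) (perp← _ _ P′) = ⊥-elim (¬perp→-perp← P P′ refl refl)
  charge-unique (perp→ _ _ P) (coll _ _ X c) with x , eq ← slot-aligned X c =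
    contradiction eq (<⇒≢ (perpendicular⇒≪ P x))
  charge-unique (perp← _ _ P) (perp→ _ _ P′) = ⊥-elim (¬perp→-perp← P′ P refl refl)
  charge-unique (perp← _ _ P) (perp← _ _ P′) = perpendicular-unique P P′
  charge-unique (perp← _ _ P) (coll _ _ X c) with x , eq ← slot-aligned X c =
    contradiction (sym eq) (<⇒≢ (perpendicular⇒≪ P x))
  charge-unique (coll _ _ X c) (perp→ _ _ P) with x , eq ← slot-aligned X c =
    contradiction eq (<⇒≢ (perpendicular⇒≪ P x))
  charge-unique (coll _ _ X c) (perp← _ _ P) with x , eq ← slot-aligned X c =
    contradiction (sym eq) (<⇒≢ (perpendicular⇒≪ P x))
  charge-unique (coll _ _ X (upperEnds _)) (coll _ _ Y (upperEnds _)) = collinear±-unique X Y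
  charge-unique (coll _ _ X (upperEnds _)) (coll _ _ Y lowerEnds)     =
    ⊥-elim (¬collinear±-collinear± X Y)
  charge-unique (coll _ _ X lowerEnds)     (coll _ _ Y (upperEnds _)) =
    ⊥-elim (¬collinear±-collinear± Y X)
  charge-unique (coll _ _ X lowerEnds)     (coll _ _ Y lowerEnds)     = collinear±-unique X Y

  -- The pairs of corners that can be charged

  record Available (k : ℕ) (A B : Stair) (p r : ℕ) : Set where
    field
      p≤     : p ≤ suc k
      r≤     : r ≤ suc k
      sides  : side A p ≡ side B r
      ≢first : (p , r) ≢ (0 , 0)
      ≢last  : (p , r) ≢ (suc k , suc k)

  perpendicular-sides : ∀ {A B Q s t} → Perpendicular A B Q s t → side A s ≡ side B (suc t)
  perpendicular-sides {B = B} {t = t} P = trans (sym dirA)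
    (trans (sym (not-involutive d)) (trans (cong not dirB) (sym (side-suc B t))))
    where open Perpendicular P

  collinear±-sides : ∀ {A B Q s t} → Collinear± A B Q s t → side A s ≡ side B t
  collinear±-sides (inj₁ X) = trans (sym (Collinear.dirA X)) (Collinear.dirB X)
  collinear±-sides (inj₂ X) = trans (sym (Collinear.dirB X)) (Collinear.dirA X)

  -- A bend charges a lower end together with an upper end, and these are neither both first nor
  -- both last corners; for collinear segments `Slot` avoids the pair of last corners.
  charge⇒available : ∀ {k A B Q p r} → 1 ≤ k → Charge k A B Q p r → Available k A B p r
  charge⇒available _ (perp→ s≤k t≤k P) = record
    { p≤ = m≤n⇒m≤1+n s≤k ; r≤ = s≤s t≤k ; sides = perpendicular-sides P
    ; ≢first = λ () ; ≢last = λ { refl → 1+n≰n s≤k } }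
  charge⇒available _ (perp← s≤k t≤k P) = record
    { p≤ = s≤s s≤k ; r≤ = m≤n⇒m≤1+n t≤k ; sides = sym (perpendicular-sides P)
    ; ≢first = λ () ; ≢last = λ { refl → 1+n≰n t≤k } }
  charge⇒available {A = A} {B} _ (coll {s} {t} s≤k t≤k X (upperEnds ≢k)) = record
    { p≤ = s≤s s≤k ; r≤ = s≤s t≤k
    ; sides = trans (side-suc A s) (trans (cong not (collinear±-sides X)) (sym (side-suc B t)))
    ; ≢first = λ () ; ≢last = λ { refl → not-last ≢k } }
    where
    not-last : ∀ {k} → ¬ (k ≢ k ⊎ k ≢ k)
    not-last (inj₁ ≢) = ≢ refl
    not-last (inj₂ ≢) = ≢ refl
  -- The pair `(k , k)` differs from the pair of first corners because `k` is positive.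
  charge⇒available {k} 1≤k (coll s≤k _ X lowerEnds) = record
    { p≤ = n≤1+n k ; r≤ = n≤1+n k ; sides = collinear±-sides X
    ; ≢first = λ { refl → 1+n≰n 1≤k } ; ≢last = λ eq → 1+n≢n (sym (cong proj₁ eq)) }

  -- Staircases of monotonic paths

  module Tracing (c r : ℕ) where
    open Grid c r

    encode : GridEdge → Edge
    encode (hor x y) = true , toℕ x , toℕ y
    encode (ver x y) = false , toℕ y , toℕ x

    encode-injective : ∀ {e f} → encode e ≡ encode f → e ≡ f
    encode-injective {hor _ _} {hor _ _} eq =
      cong₂ hor (Fin.toℕ-injective (cong (proj₁ ∘ proj₂) eq)) (Fin.toℕ-injective (cong (proj₂ ∘ proj₂) eq))
    encode-injective {ver _ _} {ver _ _} eq =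
      cong₂ ver (Fin.toℕ-injective (cong (proj₂ ∘ proj₂) eq)) (Fin.toℕ-injective (cong (proj₁ ∘ proj₂) eq))
    encode-injective {hor _ _} {ver _ _} ()
    encode-injective {ver _ _} {hor _ _} ()

    direction : GridEdge → Bool
    direction e = proj₁ (encode e)

    along across : GridEdge → ℕ
    along e  = proj₁ (proj₂ (encode e))
    across e = proj₂ (proj₂ (encode e))

    coordinate : GridPoint → Bool → ℕ
    coordinate (x , y) true  = toℕ x
    coordinate (x , y) false = toℕ y

    lower-along : ∀ e → coordinate (lower e) (direction e) ≡ along e
    lower-along (hor x _) = Fin.toℕ-inject₁ x
    lower-along (ver _ y) = Fin.toℕ-inject₁ y

    lower-across : ∀ e → coordinate (lower e) (not (direction e)) ≡ across e
    lower-across (hor _ _) = refl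
    lower-across (ver _ _) = refl

    upper-along : ∀ e → coordinate (upper e) (direction e) ≡ suc (along e)
    upper-along (hor _ _) = refl
    upper-along (ver _ _) = refl

    upper-across : ∀ e → coordinate (upper e) (not (direction e)) ≡ across e
    upper-across (hor _ _) = refl
    upper-across (ver _ _) = refl

    -- A staircase has infinitely many segments, and `sound` ranges over all of them: those behind
    -- the end of the path must not contribute edges. The number of turns enters through `complete`
    -- only.
    record Traces (S : Stair) (es : List GridEdge) : Set where
      field
        complete : ∀ {e} → e ∈ es → ∃[ s ] (s ≤ turns es × OnSegment S s (encode e))
        sound    : ∀ {f} → S ∋ f → ∃[ e ] (e ∈ es × encode e ≡ f)

    -- The induction hypothesis for prepending an edge. By `grows` the first segment may be empty
    -- but does not run backwards, so that `extend` can lengthen it.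
    record Trace (d : Bool) (p : GridPoint) (es : List GridEdge) : Set where
      field
        stair  : Stair
        starts : start stair ≡ d
        origin : ∀ x → corner stair x 0 ≡ coordinate p x
        grows  : corner stair d 0 ≤ corner stair d 1
        traces : Traces stair es

    -- Without a turn only corner 0 moves, back to the lower end of `e`.
    extend : ∀ e {es} → turns (e ∷ es) ≡ turns es →
      Trace (direction e) (upper e) es → Trace (direction e) (lower e) (e ∷ es)
    extend e {es} straight
      record { stair = S ; starts = refl ; origin = origin ; grows = grows ; traces = T } = record
      { stair  = S′
      ; starts = refl
      ; origin = λ _ → refl
      ; grows  = ≤-trans (n≤1+n _) first<
      ; traces = record { complete = complete ; sound = sound }
      }
      where
      d = direction e
      S′ : Stair
      S′ .start            = d
      S′ .corner x zero    = coordinate (lower e) x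
      S′ .corner x (suc s) = corner S x (suc s)
      S′ .level zero       = trans (level S 0)
        (trans (origin (not d)) (trans (upper-across e) (sym (lower-across e))))
      S′ .level (suc s)    = level S (suc s)

      first-origin : corner S d 0 ≡ suc (along e)
      first-origin = trans (origin d) (upper-along e)

      first< : suc (coordinate (lower e) d) ≤ corner S d 1
      first< = subst (_≤ corner S d 1) (trans first-origin (cong suc (sym (lower-along e)))) grows

      widen : ∀ {s f} → OnSegment S s f → OnSegment S′ s f
      widen {zero} (onSegment refl lo hi eq) = onSegment refl
        (≤-trans (≤-trans (≤-reflexive (lower-along e)) (n≤1+n _))
          (≤-trans (≤-reflexive (sym first-origin)) lo))
        hi
        (trans (lower-across e) (trans (sym (upper-across e)) (trans (sym (origin (not d))) eq)))
      widen {suc s} (onSegment dir lo hi eq) = onSegment dir lo hi eq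

      complete : ∀ {f} → f ∈ e ∷ es → ∃[ s ] (s ≤ turns (e ∷ es) × OnSegment S′ s (encode f))
      complete (here refl) = 0 , z≤n ,
        onSegment refl (≤-reflexive (lower-along e))
          (subst (λ u → suc u ≤ corner S d 1) (lower-along e) first<) (lower-across e)
      complete (there f∈) with s , s≤ , o ← Traces.complete T f∈ =
        s , subst (s ≤_) (sym straight) s≤ , widen o

      sound : ∀ {f} → S′ ∋ f → ∃[ g ] (g ∈ e ∷ es × encode g ≡ f)
      sound {_ , u , _} (zero , onSegment refl lo hi eq) with u ≟ along e
      ... | yes refl = e , here refl , cong (λ w → d , u , w) (trans (sym (lower-across e)) eq)
      -- An edge of the first segment other than `e` starts at the upper end of `e` or later, hence
      -- lies on the old first segment.
      ... | no  u≢
        with g , g∈ , eq′ ← Traces.sound T (0 , onSegment refl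
               (subst (_≤ u) (sym first-origin)
                 (≤∧≢⇒< (subst (_≤ u) (lower-along e) lo) (u≢ ∘ sym)))
               hi
               (trans (origin (not d)) (trans (upper-across e) (trans (sym (lower-across e)) eq)))) =
        g , there g∈ , eq′
      sound (suc s , onSegment dir lo hi eq)
        with g , g∈ , eq′ ← Traces.sound T (suc s , onSegment dir lo hi eq) = g , there g∈ , eq′

    -- After a turn `e` becomes a first segment of its own and all indices shift by one; `alternate`
    -- unfolds so that the sides shift along.
    bend : ∀ e {es} → turns (e ∷ es) ≡ suc (turns es) →
      Trace (not (direction e)) (upper e) es → Trace (direction e) (lower e) (e ∷ es)
    bend e {es} turned
      record { stair = S ; starts = refl ; origin = origin ; traces = T } = record
      { stair  = S′
      ; starts = refl
      ; origin = λ _ → refl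
      ; grows  = subst (_ ≤_) (sym first-corner) (≤-trans (≤-reflexive (lower-along e)) (n≤1+n _))
      ; traces = record { complete = complete ; sound = sound }
      }
      where
      d = direction e
      S′ : Stair
      S′ .start            = d
      S′ .corner x zero    = coordinate (lower e) x
      S′ .corner x (suc s) = corner S x s
      S′ .level zero       = trans (origin (not d)) (trans (upper-across e) (sym (lower-across e)))
      S′ .level (suc s)    = level S s

      first-corner : corner S d 0 ≡ suc (along e)
      first-corner = trans (origin d) (upper-along e)

      complete : ∀ {f} → f ∈ e ∷ es → ∃[ s ] (s ≤ turns (e ∷ es) × OnSegment S′ s (encode f))
      complete (here refl) = 0 , z≤n ,
        onSegment refl (≤-reflexive (lower-along e)) (≤-reflexive (sym first-corner)) (lower-across e)
      complete (there f∈) with s , s≤ , onSegment dir lo hi eq ← Traces.complete T f∈ =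
        suc s , subst (suc s ≤_) (sym turned) (s≤s s≤) , onSegment dir lo hi eq

      sound : ∀ {f} → S′ ∋ f → ∃[ g ] (g ∈ e ∷ es × encode g ≡ f)
      sound {_ , u , _} (zero , onSegment refl lo hi eq)
        -- The new first segment has length one, so its only edge is `e`.
        with refl ← ≤-antisym (subst (_≤ u) (lower-along e) lo)
                              (≤-pred (subst (u <_) first-corner hi)) =
        e , here refl , cong (λ w → d , u , w) (trans (sym (lower-across e)) eq)
      sound (suc s , onSegment dir lo hi eq)
        with g , g∈ , eq′ ← Traces.sound T (s , onSegment dir lo hi eq) = g , there g∈ , eq′

    Heading : Bool → List GridEdge → Set
    Heading d []      = ⊤
    Heading d (e ∷ _) = d ≡ direction e

    straight-or-turned : ∀ e es →
      (Heading (direction e) es × turns (e ∷ es) ≡ turns es) ⊎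
      (Heading (not (direction e)) es × turns (e ∷ es) ≡ suc (turns es))
    -- An empty rest counts as straight, so that the last edge opens no further segment.
    straight-or-turned e         []            = inj₁ (tt , refl)
    straight-or-turned (hor _ _) (hor _ _ ∷ _) = inj₁ (refl , refl)
    straight-or-turned (hor _ _) (ver _ _ ∷ _) = inj₂ (refl , refl)
    straight-or-turned (ver _ _) (hor _ _ ∷ _) = inj₂ (refl , refl)
    straight-or-turned (ver _ _) (ver _ _ ∷ _) = inj₁ (refl , refl)

    trace : ∀ {p q} (P : Path p q) → Monotonic P → ∀ d → Heading d (edges P) → Trace d p (edges P)
    trace (end p) _ d _ = record
      -- All corners are the end point, so every segment is degenerate, whatever the direction `d`.
      { stair  = record { start = d ; corner = λ x _ → coordinate p x ; level = λ _ → refl }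
      ; starts = refl
      ; origin = λ _ → refl
      ; grows  = ≤-refl
      ; traces = record
        { complete = λ ()
        ; sound    = λ { (_ , o) → contradiction (OnSegment.to o) (≤⇒≯ (OnSegment.from o)) }
        }
      }
    trace (forward e P) mono _ refl with straight-or-turned e (edges P)
    ... | inj₁ (heading , straight) = extend e straight (trace P mono _ heading)
    ... | inj₂ (heading , turned)   = bend e turned (trace P mono _ heading)

    heading : ∀ es → ∃[ d ] Heading d es
    heading []      = true , tt
    heading (e ∷ _) = direction e , refl

    staircase : ∀ {p q} (P : Path p q) → Monotonic P → ∃[ S ] Traces S (edges P)
    staircase P mono with d , h ← heading (edges P) = stair , traces
      where open Trace (trace P mono d h)

  -- Counting slots

  -- The indices below `N` at which the sides alternating from `d` take the value `x`.
  positions : Bool → Bool → ℕ → List ℕ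
  positions _     _     zero    = []
  positions true  true  (suc N) = 0 ∷ map suc (positions false true N)
  positions true  false (suc N) = map suc (positions false false N)
  positions false true  (suc N) = map suc (positions true true N)
  positions false false (suc N) = 0 ∷ map suc (positions true false N)

  ∈-positions : ∀ d {x p N} → p < N → alternate d p ≡ x → p ∈ positions d x N
  ∈-positions true  {p = zero}  {suc _} _         refl = here refl
  ∈-positions false {p = zero}  {suc _} _         refl = here refl
  ∈-positions true  {true}  {suc _} (s≤s p<N) eq = there (∈-map⁺ suc (∈-positions false p<N eq))
  ∈-positions true  {false} {suc _} (s≤s p<N) eq = ∈-map⁺ suc (∈-positions false p<N eq)
  ∈-positions false {true}  {suc _} (s≤s p<N) eq = ∈-map⁺ suc (∈-positions true p<N eq)
  ∈-positions false {false} {suc _} (s≤s p<N) eq = there (∈-map⁺ suc (∈-positions true p<N eq))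

  parityCount : Bool → Bool → ℕ → ℕ
  parityCount d x N = if does (d Bool.≟ x) then ⌈ N /2⌉ else ⌊ N /2⌋

  length-positions : ∀ d x N → length (positions d x N) ≡ parityCount d x N
  length-positions true  true  zero    = refl
  length-positions true  false zero    = refl
  length-positions false true  zero    = refl
  length-positions false false zero    = refl
  length-positions true  true  (suc N) =
    cong suc (trans (length-map suc (positions false true N)) (length-positions false true N))
  length-positions true  false (suc N) =
    trans (length-map suc (positions false false N)) (length-positions false false N)
  length-positions false true  (suc N) =
    trans (length-map suc (positions true true N)) (length-positions true true N)
  length-positions false false (suc N) =
    cong suc (trans (length-map suc (positions true false N)) (length-positions true false N))

  length-cartesianProduct : ∀ {X Y : Set} (xs : List X) (ys : List Y) →
    length (cartesianProduct xs ys) ≡ length xs * length ys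
  length-cartesianProduct []       ys = refl
  length-cartesianProduct (x ∷ xs) ys = trans (length-++ (map (x ,_) ys))
    (cong₂ _+_ (length-map (x ,_) ys) (length-cartesianProduct xs ys))

  matching : Bool → Bool → ℕ → List (ℕ × ℕ)
  matching d d′ N = cartesianProduct (positions d true N) (positions d′ true N)
                 ++ cartesianProduct (positions d false N) (positions d′ false N)

  ∈-matching : ∀ d d′ {p r N} → p < N → r < N → alternate d p ≡ alternate d′ r →
    (p , r) ∈ matching d d′ N
  ∈-matching d d′ {p} {r} {N} p<N r<N eq with alternate d p in eqp
  ... | true  = ∈-++⁺ˡ (∈-cartesianProduct⁺ (∈-positions d p<N eqp) (∈-positions d′ r<N (sym eq)))
  ... | false = ∈-++⁺ʳ (cartesianProduct (positions d true N) (positions d′ true N))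
                  (∈-cartesianProduct⁺ (∈-positions d p<N eqp) (∈-positions d′ r<N (sym eq)))

  length-matching : ∀ d d′ N → length (matching d d′ N) ≡
    parityCount d true N * parityCount d′ true N + parityCount d false N * parityCount d′ false N
  length-matching d d′ N = trans (length-++ (cartesianProduct (positions d true N) (positions d′ true N)))
    (cong₂ _+_ (block true) (block false))
    where
    block : ∀ x → length (cartesianProduct (positions d x N) (positions d′ x N)) ≡
      parityCount d x N * parityCount d′ x N
    block x = trans (length-cartesianProduct (positions d x N) (positions d′ x N))
      (cong₂ _*_ (length-positions d x N) (length-positions d′ x N))

  remove : ∀ {X : Set} {x : X} {xs} → x ∈ xs →
    ∃[ ys ] (length xs ≡ suc (length ys) × (∀ {y} → y ∈ xs → y ≢ x → y ∈ ys))
  remove {xs = _ ∷ ys} (here refl) = ys , refl ,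
    λ { (here eq) y≢x → contradiction eq y≢x ; (there y∈) _ → y∈ }
  remove {xs = z ∷ _} (there x∈) with ys , eq , keep ← remove x∈ = z ∷ ys , cong suc eq ,
    λ { (here eq) _ → here eq ; (there y∈) y≢x → there (keep y∈ y≢x) }

  -- With a and b the two halves of the k + 2 corners, rounded up and down, this is a² + b² - 2, and
  -- adding `extraSlots k` gives 2ab; see `aligned-count` and `mixed-count`.
  alignedSlots : ℕ → ℕ
  alignedSlots k = 2 * ⌊ suc k /2⌋ * ⌈ suc k /2⌉ + k

  extraSlots : ℕ → ℕ
  extraSlots k = 1 + (⌈ suc k /2⌉ ∸ ⌊ suc k /2⌋)

  slotCount : ℕ → Bool → Bool → ℕ
  slotCount k d d′ = if does (d Bool.≟ d′) then alignedSlots k else alignedSlots k + extraSlots k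

  ⌈/2⌉-cases : ∀ k → ⌈ k /2⌉ ≡ ⌊ k /2⌋ ⊎ ⌈ k /2⌉ ≡ suc ⌊ k /2⌋
  ⌈/2⌉-cases zero          = inj₁ refl
  ⌈/2⌉-cases (suc zero)    = inj₂ refl
  ⌈/2⌉-cases (suc (suc k)) with ⌈/2⌉-cases k
  ... | inj₁ eq = inj₁ (cong suc eq)
  ... | inj₂ eq = inj₂ (cong suc eq)

  aligned-count : ∀ k → let a = ⌈ suc (suc k) /2⌉; b = ⌊ suc (suc k) /2⌋ in
    -- By definition `⌊ suc k /2⌋` is `⌈ k /2⌉` and `⌈ suc k /2⌉` is `suc ⌊ k /2⌋`, which `identity`
    -- calls `f` and `suc h`.
    a * a + b * b ≡ 2 + alignedSlots k
  aligned-count k = trans (identity (⌈/2⌉-cases k))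
    (cong (λ k′ → 2 + (2 * ⌈ k /2⌉ * suc ⌊ k /2⌋ + k′)) (⌊n/2⌋+⌈n/2⌉≡n k))
    where
    even : ∀ h → suc h * suc h + suc h * suc h ≡ 2 + (2 * h * suc h + (h + h))
    even = solve-∀
    odd : ∀ h → suc (suc h) * suc (suc h) + suc h * suc h ≡ 2 + (2 * suc h * suc h + (h + suc h))
    odd = solve-∀
    identity : ∀ {f h} → f ≡ h ⊎ f ≡ suc h →
      suc f * suc f + suc h * suc h ≡ 2 + (2 * f * suc h + (h + f))
    identity {h = h} (inj₁ refl) = even h
    identity {h = h} (inj₂ refl) = odd h

  mixed-count : ∀ k → let a = ⌈ suc (suc k) /2⌉; b = ⌊ suc (suc k) /2⌋ in
    a * b + b * a ≡ alignedSlots k + extraSlots k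
  mixed-count k = trans (identity (⌈/2⌉-cases k))
    (cong (λ k′ → 2 * ⌈ k /2⌉ * suc ⌊ k /2⌋ + k′ + extraSlots k) (⌊n/2⌋+⌈n/2⌉≡n k))
    where
    even : ∀ h → suc h * suc h + suc h * suc h ≡ 2 * h * suc h + (h + h) + 2
    even = solve-∀
    odd : ∀ h → suc (suc h) * suc h + suc h * suc (suc h) ≡ 2 * suc h * suc h + (h + suc h) + 1
    odd = solve-∀
    identity : ∀ {f h} → f ≡ h ⊎ f ≡ suc h →
      suc f * suc h + suc h * suc f ≡ 2 * f * suc h + (h + f) + (1 + (suc h ∸ f))
    identity {h = h} (inj₁ refl) rewrite m+n∸n≡m 1 h = even h
    identity {h = h} (inj₂ refl) rewrite n∸n≡0 h = odd h

  SlotList : (k : ℕ) (d d′ : Bool) (size : ℕ) → Set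
  SlotList k d d′ size = ∃[ xs ] (length xs ≡ size ×
    (∀ {p r} → p ≤ suc k → r ≤ suc k → alternate d p ≡ alternate d′ r →
      (p , r) ≢ (0 , 0) → (p , r) ≢ (suc k , suc k) → (p , r) ∈ xs))

  slots-same : ∀ k d → SlotList k d d (alignedSlots k)
  slots-same k d
    with ys , eq , keep ← remove (∈-matching d d {0} {0} {suc (suc k)} z<s z<s refl)
    with xs , eq′ , keep′ ←
           remove (keep (∈-matching d d {suc k} {suc k} {suc (suc k)} ≤-refl ≤-refl refl) λ ())
    = xs
    , suc-injective (suc-injective (trans (sym (trans eq (cong suc eq′)))
        (trans (length-matching d d (suc (suc k))) (total d))))
    , λ p≤ r≤ sides ≢first ≢last → keep′ (keep (∈-matching d d (s≤s p≤) (s≤s r≤) sides) ≢first) ≢last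
    where
    total : ∀ d → parityCount d true (suc (suc k)) * parityCount d true (suc (suc k))
      + parityCount d false (suc (suc k)) * parityCount d false (suc (suc k)) ≡ 2 + alignedSlots k
    total true  = aligned-count k
    total false = trans (+-comm (⌊ suc (suc k) /2⌋ * ⌊ suc (suc k) /2⌋) _) (aligned-count k)

  slots : ∀ k d d′ → SlotList k d d′ (slotCount k d d′)
  slots k true  true  = slots-same k true
  slots k false false = slots-same k false
  -- With different starts the two first corners have different sides, and so have the two last
  -- ones: nothing has to be removed.
  slots k true  false = matching true false (suc (suc k))
    , trans (length-matching true false (suc (suc k))) (mixed-count k)
    , λ p≤ r≤ sides _ _ → ∈-matching true false (s≤s p≤) (s≤s r≤) sides
  slots k false true  = matching false true (suc (suc k))
    , trans (length-matching false true (suc (suc k)))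
        (trans (+-comm (⌊ suc (suc k) /2⌋ * ⌈ suc (suc k) /2⌉) _) (mixed-count k))
    , λ p≤ r≤ sides _ _ → ∈-matching false true (s≤s p≤) (s≤s r≤) sides

  -- Summing over all pairs of paths

  pairs : ∀ {X : Set} → List X → List (X × X)
  pairs []       = []
  pairs (x ∷ xs) = map (x ,_) xs ++ pairs xs

  ∈-pairs-tabulate : ∀ {X : Set} {m} (f : Fin m → X) {i j} → i Fin.< j →
    (f i , f j) ∈ pairs (tabulate f)
  ∈-pairs-tabulate f {zero}  {suc j} _ = ∈-++⁺ˡ (∈-map⁺ (f zero ,_) (∈-tabulate⁺ {f = f ∘ suc} j))
  ∈-pairs-tabulate f {suc i} {suc j} (s≤s i<j) =
    ∈-++⁺ʳ (map (f zero ,_) (tabulate (f ∘ suc))) (∈-pairs-tabulate (f ∘ suc) i<j)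

  module _ {X : Set} (colour : X → Bool) where

    count : Bool → List X → ℕ
    count b []       = 0
    count b (x ∷ xs) = (if does (colour x Bool.≟ b) then 1 else 0) + count b xs

    count-total : ∀ xs → count true xs + count false xs ≡ length xs
    count-total []       = refl
    count-total (x ∷ xs) with colour x
    ... | true  = cong suc (count-total xs)
    ... | false = trans (+-suc (count true xs) _) (cong suc (count-total xs))

    module _ {Y : Set} (k : ℕ) (f : X × X → List Y)
             (length-f : ∀ x y → length (f (x , y)) ≡ slotCount k (colour x) (colour y)) where
      private
        D = alignedSlots k
        E = extraSlots k

      length-row : ∀ x xs → length (concatMap f (map (x ,_) xs)) ≡
        length xs * D + count (not (colour x)) xs * E
      length-row x []       = refl
      length-row x (y ∷ xs) = trans (length-++ (f (x , y)))
        (trans (cong₂ _+_ (length-f x y) (length-row x xs)) step)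
        where
        same : ∀ D E l n → D + (l * D + n * E) ≡ D + l * D + n * E
        same = solve-∀
        different : ∀ D E l n → D + E + (l * D + n * E) ≡ D + l * D + (E + n * E)
        different = solve-∀
        step : slotCount k (colour x) (colour y) + (length xs * D + count (not (colour x)) xs * E) ≡
          D + length xs * D + count (not (colour x)) (y ∷ xs) * E
        step with colour x | colour y
        ... | true  | true  = same D E (length xs) (count false xs)
        ... | true  | false = different D E (length xs) (count false xs)
        ... | false | true  = different D E (length xs) (count true xs)
        ... | false | false = same D E (length xs) (count true xs)

      -- A new element adds one pair per old element, as in Pascal's rule, and one pair of different
      -- colours per old element of the other colour.
      length-pairs : ∀ xs → length (concatMap f (pairs xs)) ≡
        (length xs C 2) * D + count true xs * count false xs * E
      length-pairs []       = refl
      length-pairs (x ∷ xs) = trans (cong length (concatMap-++ f (map (x ,_) xs) (pairs xs)))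
        (trans (length-++ (concatMap f (map (x ,_) xs)))
        (trans (cong₂ _+_ (length-row x xs) (length-pairs xs))
        (trans step (cong (λ b → b * D + count true (x ∷ xs) * count false (x ∷ xs) * E) choose))))
        where
        choose : length xs + length xs C 2 ≡ suc (length xs) C 2
        choose = trans (cong (_+ length xs C 2) (sym (nC1≡n (length xs))))
          (nCk+nC[k+1]≡[n+1]C[k+1] (length xs) 1)
        white : ∀ D E l c t f → l * D + f * E + (c * D + t * f * E) ≡ (l + c) * D + suc t * f * E
        white = solve-∀
        black : ∀ D E l c t f → l * D + t * E + (c * D + t * f * E) ≡ (l + c) * D + t * suc f * E
        black = solve-∀
        step : length xs * D + count (not (colour x)) xs * E
          + ((length xs C 2) * D + count true xs * count false xs * E) ≡
          (length xs + length xs C 2) * D + count true (x ∷ xs) * count false (x ∷ xs) * E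
        step with colour x
        ... | true  = white D E (length xs) (length xs C 2) (count true xs) (count false xs)
        ... | false = black D E (length xs) (length xs C 2) (count true xs) (count false xs)

  -- The sides differ by the square of a - b, which does not change when both numbers drop by one.
  4ab≤[a+b]² : ∀ a b → 4 * (a * b) ≤ (a + b) * (a + b)
  4ab≤[a+b]² zero    b = z≤n
  4ab≤[a+b]² (suc a) zero    rewrite *-zeroʳ a = z≤n
  4ab≤[a+b]² (suc a) (suc b) = begin
    4 * (suc a * suc b)                       ≡⟨ lhs a b ⟩
    4 * (a * b) + (4 * (a + b) + 4)           ≤⟨ +-monoˡ-≤ _ (4ab≤[a+b]² a b) ⟩
    (a + b) * (a + b) + (4 * (a + b) + 4)     ≡⟨ rhs a b ⟨
    (suc a + suc b) * (suc a + suc b)         ∎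
    where
    open ≤-Reasoning
    lhs : ∀ a b → 4 * (suc a * suc b) ≡ 4 * (a * b) + (4 * (a + b) + 4)
    lhs = solve-∀
    rhs : ∀ a b → (suc a + suc b) * (suc a + suc b) ≡ (a + b) * (a + b) + (4 * (a + b) + 4)
    rhs = solve-∀

  index-injective : ∀ {X : Set} {x y : X} {xs} (p : x ∈ xs) (q : y ∈ xs) →
    index p ≡ index q → x ≡ y
  index-injective {xs = xs} p q eq =
    trans (lookup-index p) (trans (cong (lookup xs) eq) (sym (lookup-index q)))

  -- The bound in ℕ

  record Meet (k : ℕ) (A B : Stair) : Set where
    constructor meeting
    field
      {edge} : Edge
      {s t}  : ℕ
      s≤k    : s ≤ k
      t≤k    : t ≤ k
      onA    : OnSegment A s edge
      onB    : OnSegment B t edge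

  module _ {m n k : ℕ} (A : Fin m → Stair) (B : Fin n → Stair)
           (disjoint-A : ∀ {i j} → i ≢ j → Disjoint (A i) (A j))
           (unique-B : ∀ {i j e} → B i ∋ e → B j ∋ e → i ≡ j)
           (meet : ∀ j i → Meet k (A i) (B j)) where

    block : Fin n → Fin m → Fin ⌈ suc k /2⌉
    -- The number of blocks, `⌈ suc k /2⌉`, unfolds to `suc ⌊ k /2⌋`.
    block j i with meeting _ a≤k _ _ ← meet j i = fromℕ< (s≤s (⌊n/2⌋-mono a≤k))

    block-charge : ∀ j {i i′} → i′ Fin.< i → block j i′ ≡ block j i →
      ∃₂ (Charge k (A i′) (A i) (B j))
    block-charge j {i} {i′} i′<i eq
      with meeting s≤k a≤k oA oB ← meet j i
         | meeting s′≤k a′≤k oA′ oB′ ← meet j i′ =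
      charge (disjoint-A (Fin.<⇒≢ i′<i)) s′≤k s≤k oA′ oA oB′ oB (Fin.fromℕ<-injective _ _ _ _ eq)

    Earlier : Fin n → Fin m → Set
    Earlier j i = ∃[ i′ ] (i′ Fin.< i × block j i′ ≡ block j i)

    earlier? : ∀ j i → Dec (Earlier j i)
    earlier? j i = Fin.any? λ i′ → (i′ Fin.<? i) ×-dec (block j i′ Fin.≟ block j i)

    -- Of two paths in one block the smaller index is earlier than the other. So each block has at
    -- most one path without a predecessor.
    first-unique : ∀ {j i i′} → ¬ Earlier j i → ¬ Earlier j i′ → block j i ≡ block j i′ → i ≡ i′
    first-unique {i = i} {i′} first first′ eq with Fin.<-cmp i i′
    ... | tri< i<i′ _ _ = contradiction (i , i<i′ , eq) first′
    ... | tri≈ _ i≡i′ _ = i≡i′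
    ... | tri> _ _ i′<i = contradiction (i′ , i′<i , sym eq) first

    private
      Pair : Set
      Pair = Fin m × Fin m

      pairSlots : Pair → List (Pair × ℕ × ℕ)
      pairSlots (i′ , i) = map ((i′ , i) ,_) (proj₁ (slots k (start (A i′)) (start (A i))))

      allSlots : List (Pair × ℕ × ℕ)
      allSlots = concatMap pairSlots (pairs (allFin m))

      length-pairSlots : ∀ i′ i →
        length (pairSlots (i′ , i)) ≡ slotCount k (start (A i′)) (start (A i))
      length-pairSlots i′ i with xs , eq , _ ← slots k (start (A i′)) (start (A i)) =
        trans (length-map ((i′ , i) ,_) xs) eq

    ∈-allSlots : ∀ {i′ i p r} → i′ Fin.< i → Available k (A i′) (A i) p r →
      ((i′ , i) , p , r) ∈ allSlots
    ∈-allSlots {i′} {i} i′<i available = ∈-concatMap⁺ pairSlots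
      (Any.map (λ { refl → ∈-map⁺ ((i′ , i) ,_)
          (proj₂ (proj₂ (slots k (start (A i′)) (start (A i)))) p≤ r≤ sides ≢first ≢last) })
        (∈-pairs-tabulate (λ x → x) i′<i))
      where open Available available

    -- By `charge-unique` the two paths of the second class share an edge, so they coincide; `i` is
    -- recorded in the slot.
    charge-injective : ∀ {j j′ i₁ i₂ i i′ p r p′ r′} →
      Charge k (A i₁) (A i) (B j) p r → Charge k (A i₂) (A i′) (B j′) p′ r′ →
      ((i₁ , i) , p , r) ≡ ((i₂ , i′) , p′ , r′) → (j , i) ≡ (j′ , i′)
    charge-injective c c′ refl with _ , Q∋ , R∋ ← charge-unique c c′ = cong (_, _) (unique-B Q∋ R∋)

    module _ (1≤k : 1 ≤ k) where

      -- The double count as an injection: path `i` on path `j` goes to the slot charged with some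
      -- predecessor in its block, or to the block itself if there is none.
      target : Fin n × Fin m → Fin (length allSlots) ⊎ (Fin n × Fin ⌈ suc k /2⌉)
      target (j , i) with earlier? j i
      ... | yes (_ , i′<i , eq) =
        inj₁ (index (∈-allSlots i′<i (charge⇒available 1≤k (proj₂ (proj₂ (block-charge j i′<i eq))))))
      ... | no _ = inj₂ (j , block j i)

      target-injective : ∀ {x y} → target x ≡ target y → x ≡ y
      target-injective {j , i} {j′ , i′} eq with earlier? j i | earlier? j′ i′
      ... | yes (_ , lt , b) | yes (_ , lt′ , b′) =
        charge-injective (proj₂ (proj₂ (block-charge j lt b))) (proj₂ (proj₂ (block-charge j′ lt′ b′)))
          (index-injective (∈-allSlots lt _) (∈-allSlots lt′ _) (inj₁-injective eq))
      ... | no first | no first′ with refl ← cong proj₁ (inj₂-injective eq) =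
        cong (j ,_) (first-unique first first′ (cong proj₂ (inj₂-injective eq)))

      target-↣ : Fin (n * m) ↣ Fin (length allSlots + n * ⌈ suc k /2⌉)
      target-↣ = ↔⇒↣ (↔-sym (Fin.+↔⊎ {length allSlots}))
        ↣-∘ (↔⇒↣ (↔-id _ ⊎-↔ ↔-sym (Fin.*↔× {n}))
        ↣-∘ (mk↣ target-injective
        ↣-∘ ↔⇒↣ (Fin.*↔× {n})))

      staircase-bound : ∃[ x ] (4 * x ≤ m * m ×
        n * m ≤ (m C 2) * alignedSlots k + x * extraSlots k + n * ⌈ suc k /2⌉)
      -- The witness is the number of pairs of paths that start in different directions.
      staircase-bound = t * f
        , subst (λ l → 4 * (t * f) ≤ l * l) t+f≡m (4ab≤[a+b]² t f)
        , subst (λ l → n * m ≤ l + n * ⌈ suc k /2⌉) total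
            (Fin.injective⇒≤ (Injection.injective target-↣))
        where
        colour = start ∘ A
        t = count colour true (allFin m)
        f = count colour false (allFin m)
        m′≡m : length (allFin m) ≡ m
        m′≡m = length-tabulate {n = m} (λ i → i)
        t+f≡m : t + f ≡ m
        t+f≡m = trans (count-total colour (allFin m)) m′≡m
        total : length allSlots ≡ (m C 2) * alignedSlots k + t * f * extraSlots k
        total = trans (length-pairs colour k pairSlots length-pairSlots (allFin m))
          (cong (λ l → (l C 2) * alignedSlots k + t * f * extraSlots k) m′≡m)

  -- Without bends, any two paths of the second class contain the gap between the
  -- same two paths of the first class.
  bends-needed : ∀ {m n} (A : Fin (suc (suc m)) → Stair) (B : Fin (suc (suc n)) → Stair) →
    (∀ {i j} → i ≢ j → Disjoint (A i) (A j)) →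
    (∀ {i j e} → B i ∋ e → B j ∋ e → i ≡ j) →
    ¬ (∀ j i → Meet 0 (A i) (B j))
  bends-needed A B disjoint-A unique-B meet =
    let _ , Q∋ , R∋ = collinear±-unique (collinear zero) (collinear (suc zero))
    in contradiction (unique-B Q∋ R∋) λ ()
    where
    collinear : ∀ j → Collinear± (A zero) (A (suc zero)) (B j) 0 0
    collinear j with meeting z≤n z≤n oA oB ← meet j zero
                   | meeting z≤n z≤n oA′ oB′ ← meet j (suc zero) =
      ≡side⇒collinear± (disjoint-A λ ()) oA oA′ oB oB′

  -- From representations to staircases

  module _ {k : ℕ} {G : Graph} (representation : HasMonotonicEPG k G) where
    private
      R     = proj₁ representation
      paths = proj₂ representation
    open Graph G
    open EPGRepresentation R
    open Tracing c r

    stairOf : Vertex → Stair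
    stairOf v = proj₁ (staircase (path v) (proj₁ (paths v)))

    private
      tracesOf : ∀ v → Traces (stairOf v) (edges (path v))
      tracesOf v = proj₂ (staircase (path v) (proj₁ (paths v)))

    stairs-meet⇒adjacent : ∀ {v w e} → v ≢ w → stairOf v ∋ e → stairOf w ∋ e → Adj v w
    stairs-meet⇒adjacent {v} {w} v≢w ∋e ∋e′
      with g , g∈ , refl ← Traces.sound (tracesOf v) ∋e
      with h , h∈ , eq ← Traces.sound (tracesOf w) ∋e′
      with refl ← encode-injective eq = Equivalence.from (represents v w v≢w) (g , g∈ , h∈)

    adjacent⇒stairs-meet : ∀ {v w} → v ≢ w → Adj v w → Meet k (stairOf v) (stairOf w)
    adjacent⇒stairs-meet {v} {w} v≢w adj
      with g , g∈v , g∈w ← Equivalence.to (represents v w v≢w) adj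
      with _ , s≤ , o ← Traces.complete (tracesOf v) g∈v
         | _ , a≤ , o′ ← Traces.complete (tracesOf w) g∈w =
      meeting (≤-trans s≤ (proj₂ (paths v))) (≤-trans a≤ (proj₂ (paths w))) o o′

  module _ {m n k : ℕ} (representation : HasMonotonicEPG k (K m n)) where
    private
      A : Fin m → Stair
      A i = stairOf representation (inj₁ i)

      B : Fin n → Stair
      B j = stairOf representation (inj₂ j)

      disjoint-A : ∀ {i j} → i ≢ j → Disjoint (A i) (A j)
      -- Adjacency within a class is the empty type, so this is a refutation.
      disjoint-A i≢j = stairs-meet⇒adjacent representation (i≢j ∘ inj₁-injective)

      unique-B : ∀ {i j e} → B i ∋ e → B j ∋ e → i ≡ j
      unique-B {i} {j} ∋e ∋e′ with i Fin.≟ j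
      ... | yes i≡j = i≡j
      ... | no  i≢j
        with () ← stairs-meet⇒adjacent representation (i≢j ∘ inj₂-injective) ∋e ∋e′

      meet : ∀ j i → Meet k (A i) (B j)
      meet j i = adjacent⇒stairs-meet representation (λ ()) _

    monotonic-bound : 3 ≤ m → m ≤ n → ∃[ x ] (4 * x ≤ m * m ×
      n * m ≤ (m C 2) * alignedSlots k + x * extraSlots k + n * ⌈ suc k /2⌉)
    monotonic-bound _ _ with k ≟ 0
    -- There is no representation with `k = 0`, since each class has at least two paths.
    monotonic-bound (s≤s (s≤s _)) (s≤s (s≤s _)) | yes refl =
      contradiction meet (bends-needed A B disjoint-A unique-B)
    monotonic-bound _ _ | no k≢0 = staircase-bound A B disjoint-A unique-B meet (n≢0⇒n>0 k≢0)

-- Passing to ℚ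

open import Data.Rational using (1ℚ; _/_; _+_; _*_; _-_; -_; _≤_; toℚᵘ; NonNegative)

-- Reduces sums, products and order of the normalised rationals `fromℕ a` to those of integers over
-- the denominator 1.
toℚᵘ-fromℕ : ∀ a → toℚᵘ (fromℕ a) ℚᵘ.≃ ℚᵘ.mkℚᵘ (+ a) 0
toℚᵘ-fromℕ a = ℚ.toℚᵘ-fromℚᵘ (ℚᵘ.mkℚᵘ (+ a) 0)

fromℕ-+ : ∀ a b → fromℕ (a ℕ.+ b) ≡ fromℕ a + fromℕ b
fromℕ-+ a b = ℚ.toℚᵘ-injective (begin
  toℚᵘ (fromℕ (a ℕ.+ b))                      ≈⟨ toℚᵘ-fromℕ (a ℕ.+ b) ⟩
  ℚᵘ.mkℚᵘ (+ (a ℕ.+ b)) 0                     ≈⟨ ℚᵘ.*≡* (cong (ℤ._* + 1) (sym over-1)) ⟩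
  ℚᵘ.mkℚᵘ (+ a) 0 ℚᵘ.+ ℚᵘ.mkℚᵘ (+ b) 0        ≈⟨ ℚᵘ.+-cong (toℚᵘ-fromℕ a) (toℚᵘ-fromℕ b) ⟨
  toℚᵘ (fromℕ a) ℚᵘ.+ toℚᵘ (fromℕ b)          ≈⟨ ℚ.toℚᵘ-homo-+ (fromℕ a) (fromℕ b) ⟨
  toℚᵘ (fromℕ a + fromℕ b)                    ∎)
  where
  open ℚᵘ.≃-Reasoning
  over-1 : + a ℤ.* + 1 ℤ.+ + b ℤ.* + 1 ≡ + (a ℕ.+ b)
  over-1 = cong₂ ℤ._+_ (ℤ.*-identityʳ (+ a)) (ℤ.*-identityʳ (+ b))

fromℕ-* : ∀ a b → fromℕ (a ℕ.* b) ≡ fromℕ a * fromℕ b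
fromℕ-* a b = ℚ.toℚᵘ-injective (begin
  toℚᵘ (fromℕ (a ℕ.* b))                      ≈⟨ toℚᵘ-fromℕ (a ℕ.* b) ⟩
  ℚᵘ.mkℚᵘ (+ (a ℕ.* b)) 0                     ≈⟨ ℚᵘ.*≡* (cong (ℤ._* + 1) (ℤ.pos-* a b)) ⟩
  ℚᵘ.mkℚᵘ (+ a) 0 ℚᵘ.* ℚᵘ.mkℚᵘ (+ b) 0        ≈⟨ ℚᵘ.*-cong (toℚᵘ-fromℕ a) (toℚᵘ-fromℕ b) ⟨
  toℚᵘ (fromℕ a) ℚᵘ.* toℚᵘ (fromℕ b)          ≈⟨ ℚ.toℚᵘ-homo-* (fromℕ a) (fromℕ b) ⟨
  toℚᵘ (fromℕ a * fromℕ b)                    ∎)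
  where open ℚᵘ.≃-Reasoning

fromℕ-mono-≤ : ∀ {a b} → a ℕ.≤ b → fromℕ a ≤ fromℕ b
fromℕ-mono-≤ {a} {b} a≤b = ℚ.toℚᵘ-cancel-≤
  (ℚᵘ.≤-respˡ-≃ (ℚᵘ.≃-sym (toℚᵘ-fromℕ a)) (ℚᵘ.≤-respʳ-≃ (ℚᵘ.≃-sym (toℚᵘ-fromℕ b))
    (ℚᵘ.*≤* (ℤ.*-monoʳ-≤-nonNeg (+ 1) (ℤ.+≤+ a≤b)))))

fromℕ-nonNegative : ∀ a → NonNegative (fromℕ a)
fromℕ-nonNegative a = ℚ.normalize-nonNeg a 1

quarter-bound : ∀ x {y} → 4 ℕ.* x ℕ.≤ y → fromℕ x ≤ (+ 1 / 4) * fromℕ y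
quarter-bound x {y} 4x≤y = begin
  -- The product of 1/4 and 4 evaluates to 1.
  fromℕ x                           ≡⟨ ℚ.*-identityˡ (fromℕ x) ⟨
  ((+ 1 / 4) * fromℕ 4) * fromℕ x   ≡⟨ ℚ.*-assoc (+ 1 / 4) (fromℕ 4) (fromℕ x) ⟩
  (+ 1 / 4) * (fromℕ 4 * fromℕ x)   ≡⟨ cong ((+ 1 / 4) *_) (fromℕ-* 4 x) ⟨
  (+ 1 / 4) * fromℕ (4 ℕ.* x)       ≤⟨ ℚ.*-monoˡ-≤-nonNeg (+ 1 / 4) (fromℕ-mono-≤ 4x≤y) ⟩
  (+ 1 / 4) * fromℕ y               ∎
  where open ℚ.≤-Reasoning

-- The truncated subtraction is exact because rounding down gives at most rounding up.
fromℕ-extraSlots : ∀ k →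
  fromℕ (extraSlots k) ≡ 1ℚ + fromℕ ⌈ ℕ.suc k /2⌉ - fromℕ ⌊ ℕ.suc k /2⌋
fromℕ-extraSlots k = begin
  fromℕ (1 ℕ.+ (c ℕ.∸ f))                      ≡⟨ fromℕ-+ 1 (c ℕ.∸ f) ⟩
  1ℚ + fromℕ (c ℕ.∸ f)                         ≡⟨ cancel (fromℕ (c ℕ.∸ f)) (fromℕ f) ⟩
  1ℚ + (fromℕ (c ℕ.∸ f) + fromℕ f) - fromℕ f   ≡⟨ cong (λ q → 1ℚ + q - fromℕ f) (fromℕ-+ (c ℕ.∸ f) f) ⟨
  1ℚ + fromℕ (c ℕ.∸ f ℕ.+ f) - fromℕ f         ≡⟨ cong (λ a → 1ℚ + fromℕ a - fromℕ f) c∸f+f≡c ⟩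
  1ℚ + fromℕ c - fromℕ f                       ∎
  where
  open ≡-Reasoning
  c = ⌈ ℕ.suc k /2⌉
  f = ⌊ ℕ.suc k /2⌋
  c∸f+f≡c : c ℕ.∸ f ℕ.+ f ≡ c
  c∸f+f≡c = ℕ.m∸n+n≡m (ℕ.⌊n/2⌋≤⌈n/2⌉ (ℕ.suc k))
  cancel : ∀ x y → 1ℚ + x ≡ 1ℚ + (x + y) - y
  cancel = solve 2 (λ x y → con 1ℚ :+ x := con 1ℚ :+ (x :+ y) :- y) refl
    where open +-*-Solver

lemma2p6 : (m n k : ℕ) → 3 ℕ.≤ m → m ℕ.≤ n → HasMonotonicEPG k (K m n) →
    fromℕ n * (fromℕ m - fromℕ ⌈ k ℕ.+ 1 /2⌉) ≤
    fromℕ (m C 2) * fromℕ (2 ℕ.* ⌊ k ℕ.+ 1 /2⌋ ℕ.* ⌈ k ℕ.+ 1 /2⌉ ℕ.+ k)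
    + (+ 1 / 4) * fromℕ (m ℕ.^ 2) * (1ℚ + fromℕ ⌈ k ℕ.+ 1 /2⌉ - fromℕ ⌊ k ℕ.+ 1 /2⌋)
-- The rewrites turn `k + 1` into `suc k`, and `m ^ 2`, which unfolds to `m * (m * 1)`, into
-- `m * m`.
lemma2p6 m n k 3≤m m≤n representation rewrite ℕ.+-comm k 1 | ℕ.*-identityʳ m
  with x , 4x≤m² , bound ← monotonic-bound representation 3≤m m≤n = begin
  fromℕ n * (fromℕ m - fromℕ c)
    ≡⟨ distribute (fromℕ n) (fromℕ m) (fromℕ c) ⟩
  fromℕ n * fromℕ m - fromℕ n * fromℕ c
    ≡⟨ cong₂ _-_ (fromℕ-* n m) (fromℕ-* n c) ⟨
  fromℕ (n ℕ.* m) - fromℕ (n ℕ.* c)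
    ≤⟨ ℚ.+-monoˡ-≤ (- fromℕ (n ℕ.* c)) (fromℕ-mono-≤ bound) ⟩
  fromℕ (a ℕ.+ b ℕ.+ n ℕ.* c) - fromℕ (n ℕ.* c)
    ≡⟨ cong (_- fromℕ (n ℕ.* c)) (fromℕ-+ (a ℕ.+ b) (n ℕ.* c)) ⟩
  fromℕ (a ℕ.+ b) + fromℕ (n ℕ.* c) - fromℕ (n ℕ.* c)
    ≡⟨ cancel (fromℕ (a ℕ.+ b)) (fromℕ (n ℕ.* c)) ⟩
  fromℕ (a ℕ.+ b)
    ≡⟨ fromℕ-+ a b ⟩
  fromℕ a + fromℕ b
    ≡⟨ cong₂ _+_ (fromℕ-* (m C 2) (alignedSlots k)) (fromℕ-* x (extraSlots k)) ⟩
  main + fromℕ x * extra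
    ≤⟨ ℚ.+-monoʳ-≤ main (ℚ.*-monoʳ-≤-nonNeg extra {{fromℕ-nonNegative (extraSlots k)}}
         (quarter-bound x 4x≤m²)) ⟩
  main + quarter * extra
    ≡⟨ cong (λ e → main + quarter * e) (fromℕ-extraSlots k) ⟩
  main + quarter * (1ℚ + fromℕ c - fromℕ ⌊ ℕ.suc k /2⌋)
    ∎
  where
  open ℚ.≤-Reasoning
  open +-*-Solver
  c = ⌈ ℕ.suc k /2⌉
  a = (m C 2) ℕ.* alignedSlots k
  b = x ℕ.* extraSlots k
  main    = fromℕ (m C 2) * fromℕ (alignedSlots k)
  extra   = fromℕ (extraSlots k)
  quarter = (+ 1 / 4) * fromℕ (m ℕ.* m)
  distribute : ∀ x y z → x * (y - z) ≡ x * y - x * z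
  distribute = solve 3 (λ x y z → x :* (y :- z) := x :* y :- x :* z) refl
  cancel : ∀ x y → x + y - y ≡ x
  cancel = solve 2 (λ x y → x :+ y :- y := x) refl
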